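{- Let $P_n$ be the path on $n$ vertices, where $n\geq 3$, and let $k,t$ be positive integers. If $k \leq 1 + \lfloor \frac{n}{2} \rfloor$, then $\rho'(P_n^k) = 1$. Moreover, if $t \leq \lfloor \frac{n}{2} \rfloor$, then $\rho(P_n^t) = 1$.
   Context: $G^k$ denotes the $k$-th Cartesian power of $G$: $G^1=G$ and $G^k=G\square G^{k-1}$, where $\square$ is the Cartesian product of graphs. A vertex (or edge) coloring of a graph is distinguishing if no automorphism other than the identity preserves it. $D(G)$ (resp. $D'(G)$) is the least number of colors in a distinguishing vertex (resp. edge) coloring of $G$. When $D(G)=2$, the cost of distinguishing $\rho(G)$ is the minimum number of vertices in the smaller color class over all distinguishing vertex colorings of $G$ with two colors. When $D'(G)=2$, the cost of edge-distinguishing $\rho'(G)$ is the minimum number of edges in the smaller color class over all distinguishing edge colorings of $G$ with two colors. -}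

module Defs where

open import Data.Fin using (Fin; zero; suc; toℕ)
open import Data.Nat using (ℕ; zero; suc; _≤_; _⊓_; NonZero)
open import Data.Nat.Properties using (1+n≢n)
open import Data.Product using (Σ; _×_; _,_; proj₁; ∃-syntax)
open import Data.Sum using (_⊎_; inj₁; inj₂; [_,_])
open import Function using (_↔_; _⇔_; Equivalence; Func; Inverse)
open import Level using (0ℓ)
open import Relation.Binary using (Setoid)
import Relation.Binary.Construct.On as On
open import Relation.Binary.PropositionalEquality
  using (_≡_; refl; sym; trans; setoid)
open import Relation.Nullary using (¬_)

record Graph : Set₁ where
  infix 4 _~_
  field
    Vertex   : Set
    _~_      : Vertex → Vertex → Set
    ~-sym    : ∀ {u v} → u ~ v → v ~ u
    ~-irrefl : ∀ {v} → ¬ (v ~ v)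

Path : ℕ → Graph
Path n = record
  { Vertex   = Fin n
  ; _~_      = λ i j → suc (toℕ i) ≡ toℕ j ⊎ suc (toℕ j) ≡ toℕ i
  ; ~-sym    = λ { (inj₁ p) → inj₂ p ; (inj₂ p) → inj₁ p }
  ; ~-irrefl = [ 1+n≢n , 1+n≢n ]
  }

infixr 7 _□_
_□_ : Graph → Graph → Graph
G □ H = record
  { Vertex   = G.Vertex × H.Vertex
  ; _~_      = λ (g , h) (g′ , h′) → (g ≡ g′ × h H.~ h′) ⊎ (g G.~ g′ × h ≡ h′)
  ; ~-sym    = λ { (inj₁ (p , q)) → inj₁ (sym p , H.~-sym q)
                 ; (inj₂ (p , q)) → inj₂ (G.~-sym p , sym q) }
  ; ~-irrefl = λ { (inj₁ (_ , q)) → H.~-irrefl q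
                 ; (inj₂ (p , _)) → G.~-irrefl p }
  }
  where
  module G = Graph G
  module H = Graph H

infix 8 _^□_
_^□_ : Graph → (k : ℕ) .{{_ : NonZero k}} → Graph
G ^□ suc zero    = G
G ^□ suc (suc k) = G □ (G ^□ suc k)

record Automorphism (G : Graph) : Set where
  open Graph G
  field
    bijection : Vertex ↔ Vertex
  open Inverse bijection public using (to; from)
  field
    preserves : ∀ {u v} → u ~ v ⇔ to u ~ to v

module _ (G : Graph) where
  open Graph G

  record Edge : Set where
    constructor edge
    field
      end₁ end₂ : Vertex
      adjacent  : end₁ ~ end₂

  open Edge

  -- Edges are unordered: an edge is identified with its reversal, and the
  -- adjacency proof is ignored.
  infix 4 _≈ₑ_
  _≈ₑ_ : Edge → Edge → Set
  e ≈ₑ f = (end₁ e ≡ end₁ f × end₂ e ≡ end₂ f)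
         ⊎ (end₁ e ≡ end₂ f × end₂ e ≡ end₁ f)

  Vertices : Setoid 0ℓ 0ℓ
  Vertices = setoid Vertex

  Edges : Setoid 0ℓ 0ℓ
  Edges = record
    { Carrier       = Edge
    ; _≈_           = _≈ₑ_
    ; isEquivalence = record
      { refl  = inj₁ (refl , refl)
      ; sym   = λ { (inj₁ (p , q)) → inj₁ (sym p , sym q)
                  ; (inj₂ (p , q)) → inj₂ (sym q , sym p) }
      ; trans = λ { (inj₁ (p , q)) (inj₁ (r , s)) → inj₁ (trans p r , trans q s)
                  ; (inj₁ (p , q)) (inj₂ (r , s)) → inj₂ (trans p r , trans q s)
                  ; (inj₂ (p , q)) (inj₁ (r , s)) → inj₂ (trans p s , trans q r)
                  ; (inj₂ (p , q)) (inj₂ (r , s)) → inj₁ (trans p s , trans q r) }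
      }
    }

mapEdge : ∀ {G} → Automorphism G → Edge G → Edge G
mapEdge φ (edge u v u~v) = edge (to u) (to v) (Equivalence.to preserves u~v)
  where open Automorphism φ

Colouring : Setoid 0ℓ 0ℓ → ℕ → Set
Colouring S d = Func S (setoid (Fin d))

ColourClass : ∀ {S d} → Colouring S d → Fin d → Setoid 0ℓ 0ℓ
ColourClass {S} c i = On.setoid {B = Σ (Setoid.Carrier S) λ x → Func.to c x ≡ i} S proj₁

HasSize : Setoid 0ℓ 0ℓ → ℕ → Set
HasSize S m = Inverse (setoid (Fin m)) S

IsLeast : (ℕ → Set) → ℕ → Set
IsLeast P m = P m × (∀ n → P n → m ≤ n)

module _ (G : Graph) where
  open Graph G

  IsIdentity : Automorphism G → Set
  IsIdentity φ = ∀ v → Automorphism.to φ v ≡ v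

  Distinguishing : ∀ {d} → Colouring (Vertices G) d → Set
  Distinguishing c = (φ : Automorphism G) →
    (∀ v → Func.to c (Automorphism.to φ v) ≡ Func.to c v) → IsIdentity φ

  EdgeDistinguishing : ∀ {d} → Colouring (Edges G) d → Set
  EdgeDistinguishing c = (φ : Automorphism G) →
    (∀ e → Func.to c (mapEdge φ e) ≡ Func.to c e) → IsIdentity φ

SmallerClassSize : ∀ {S} → Colouring S 2 → ℕ → Set
SmallerClassSize c m = ∃[ a ] ∃[ b ]
  HasSize (ColourClass c zero) a × HasSize (ColourClass c (suc zero)) b × m ≡ a ⊓ b

-- The invariants D, D′, ρ and ρ′ are given as relations: "D G is d" means
-- D(G) = d, and likewise for the others. The costs are meant for finite
-- graphs, where both colour classes have a size in ℕ; they are only defined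
-- when the corresponding distinguishing number is 2, so "ρ G is m" includes
-- D(G) = 2.
infix 4 D_is_ D′_is_ ρ_is_ ρ′_is_

D_is_ : Graph → ℕ → Set
D G is d = IsLeast (λ e → ∃[ c ] Distinguishing G {e} c) d

D′_is_ : Graph → ℕ → Set
D′ G is d = IsLeast (λ e → ∃[ c ] EdgeDistinguishing G {e} c) d

ρ_is_ : Graph → ℕ → Set
ρ G is m = D G is 2
  × IsLeast (λ s → ∃[ c ] Distinguishing G {2} c × SmallerClassSize c s) m

ρ′_is_ : Graph → ℕ → Set
ρ′ G is m = D′ G is 2
  × IsLeast (λ s → ∃[ c ] EdgeDistinguishing G {2} c × SmallerClassSize c s) m

{-# OPTIONS --safe #-}
module Submission where

-- A single coloured vertex (or edge) suffices. An automorphism preserves the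
-- ℓ¹ distance, and hence the corners, which are the vertices that have another
-- vertex at the maximal distance. If a has coordinates below half of n − 1 and
-- is fixed, then so is the origin, as the only corner nearest to a. The corners
-- nearest to the origin are the "spikes" (0,…,n−1,…,0); d(v, spike j) determines
-- v_j once d(v, origin) is known, so each spike j is fixed as soon as the fixed
-- vertices tell the coordinates apart, and then every v is fixed.
-- For ρ take a = (0,1,…,t−1). For ρ′ take the edge between a = (0,0,1,…,k−2)
-- and b = (1,0,1,…,k−2): its ends cannot be swapped, as b is farther from all
-- corners than a is from the origin, and they tell the coordinates apart.

open import Data.Bool using (Bool; if_then_else_)
open import Data.Fin using (Fin; zero; suc; toℕ; fromℕ; fromℕ<; inject₁; opposite)
import Data.Fin.Properties as Fin
open import Data.List using (List; []; _∷_; map; lookup; deduplicate; cartesianProduct; allFin)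
open import Data.List.Membership.Propositional using (_∈_)
open import Data.List.Membership.Propositional.Properties
  using (∈-allFin; ∈-cartesianProduct⁺; ∈-lookup)
import Data.List.Relation.Unary.All as All
open import Data.List.Relation.Unary.AllPairs using (_∷_)
open import Data.List.Relation.Unary.Any as Any using (Any; here; there)
import Data.List.Relation.Unary.Any.Properties as Any
open import Data.List.Relation.Unary.Enumerates.Setoid using (IsEnumeration)
open import Data.List.Relation.Unary.Enumerates.Setoid.Properties using (deduplicate⁺)
open import Data.List.Relation.Unary.Unique.DecSetoid.Properties using (deduplicate-!)
open import Data.List.Relation.Unary.Unique.Setoid using (Unique)
open import Data.Nat using (ℕ; zero; suc; _≤_; _<_; _+_; _∸_; _⊓_; ∣_-_∣; ⌊_/2⌋; ⌈_/2⌉; NonZero;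
  z≤n; s≤s; s≤s⁻¹)
open import Data.Nat.Properties renaming (_≟_ to _≟ℕ_)
open import Data.Product using (Σ; ∃-syntax; _×_; _,_; proj₁; proj₂)
open import Data.Product.Properties using (≡-dec)
open import Data.Sum as Sum using (_⊎_; inj₁; inj₂; [_,_])
open import Data.Vec.Functional using (updateAt) renaming (_∷_ to _◂_)
open import Data.Vec.Functional.Properties using (updateAt-updates; updateAt-minimal)
open import Function using (_∘_; const; mk⇔; Equivalence; Func; Inverse; mk↔ₛ′)
open import Level using (0ℓ)
open import Relation.Binary using (Setoid; DecSetoid; Decidable; DecidableEquality)
import Relation.Binary.Construct.On as On
open import Relation.Binary.PropositionalEquality hiding (setoid; [_])
import Relation.Binary.PropositionalEquality as ≡
open import Relation.Nullary using (¬_; yes; no; does; contradiction)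
open import Relation.Nullary.Decidable using (_×-dec_; _⊎-dec_; dec-true; dec-false)
import Relation.Unary as Unary

open import Algebra.Properties.CommutativeMonoid.Sum +-0-commutativeMonoid
  using (sum; sum-cong-≗; sum-replicate-zero; ∑-distrib-+)
open import Defs

-- Finite setoids and the cost of a colouring property

lookup-injective : (S : Setoid 0ℓ 0ℓ) → let open Setoid S in
  ∀ {xs} → Unique S xs → ∀ i j → lookup xs i ≈ lookup xs j → i ≡ j
lookup-injective S (_ ∷ _)   zero    zero    _ = refl
lookup-injective S (x∉ ∷ _)  zero    (suc j) p =
  contradiction p (All.lookup x∉ (∈-lookup j))
lookup-injective S (x∉ ∷ _)  (suc i) zero    p =
  contradiction (Setoid.sym S p) (All.lookup x∉ (∈-lookup i))
lookup-injective S (_ ∷ xs!) (suc i) (suc j) p =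
  cong suc (lookup-injective S xs! i j p)

-- After removal of duplicates up to `≈`, the position of an element in the list is unique and
-- inverts `lookup`.
enumerated⇒HasSize : (S? : DecSetoid 0ℓ 0ℓ) → let open DecSetoid S? using (setoid) in
  ∀ {xs} → IsEnumeration setoid xs → ∃[ m ] HasSize setoid m
enumerated⇒HasSize S? {xs} enum = _ , record
  { to        = lookup ys
  ; from      = index
  ; to-cong   = λ { refl → refl≈ }
  ; from-cong = λ {x} {y} x≈y → lookup-inj _ _
      (trans≈ (sym≈ (lookup-index x)) (trans≈ x≈y (lookup-index y)))
  ; inverse   = (λ { {x} refl → sym≈ (lookup-index x) })
              , (λ {i} {x} x≈yᵢ → lookup-inj _ _ (trans≈ (sym≈ (lookup-index x)) x≈yᵢ))
  }
  where
  open DecSetoid S? using (setoid; _≈_; _≟_)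
    renaming (refl to refl≈; sym to sym≈; trans to trans≈)
  ys = deduplicate _≟_ xs
  ∈ys = deduplicate⁺ S? enum
  index = λ x → Any.index (∈ys x)
  lookup-index : ∀ x → x ≈ lookup ys (index x)
  lookup-index x = Any.lookup-index (∈ys x)
  lookup-inj = lookup-injective setoid (deduplicate-! S? xs)

module _ {A : Set} {P : A → Set} (P? : Unary.Decidable P) where

  restrict : List A → List (Σ A P)
  restrict []       = []
  restrict (x ∷ xs) with P? x
  ... | yes p = (x , p) ∷ restrict xs
  ... | no  _ = restrict xs

  -- `Q` is arbitrary so that membership up to a setoid equality is covered as well as membership up
  -- to `≡`.
  restrict⁺ : {Q : A → Set} → (∀ {x} → Q x → P x) →
    ∀ {xs} → Any Q xs → Any (Q ∘ proj₁) (restrict xs)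
  restrict⁺ Q⊆P {x ∷ xs} any with P? x | any
  ... | yes _  | here q  = here q
  ... | yes _  | there i = there (restrict⁺ Q⊆P i)
  ... | no  ¬p | here q  = contradiction (Q⊆P q) ¬p
  ... | no  _  | there i = restrict⁺ Q⊆P i

module _ (S? : DecSetoid 0ℓ 0ℓ) where
  open DecSetoid S? using (_≈_; _≟_; Carrier)
    renaming (setoid to S; refl to refl≈; sym to sym≈; trans to trans≈)

  private
    bit : Bool → Fin 2
    bit b = if b then suc zero else zero

  indicator : Carrier → Colouring S 2
  indicator p = record
    { to   = λ x → bit (does (x ≟ p))
    ; cong = λ {x} {y} x≈y → cong bit (does-cong x≈y)
    }
    where
    does-cong : ∀ {x y} → x ≈ y → does (x ≟ p) ≡ does (y ≟ p)
    does-cong {x} {y} x≈y with x ≟ p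
    ... | yes x≈p = sym (dec-true  (y ≟ p) (trans≈ (sym≈ x≈y) x≈p))
    ... | no  x≉p = sym (dec-false (y ≟ p) (x≉p ∘ trans≈ x≈y))

  indicator-self : ∀ p → Func.to (indicator p) p ≡ suc zero
  indicator-self p = cong bit (dec-true (p ≟ p) refl≈)

  indicator⇒≈ : ∀ {p x} → Func.to (indicator p) x ≡ suc zero → x ≈ p
  indicator⇒≈ {p} {x} eq with x ≟ p
  ... | yes x≈p = x≈p
  indicator⇒≈ {p} {x} () | no _

  HasSize-indicator : ∀ p → HasSize (ColourClass (indicator p) (suc zero)) 1
  HasSize-indicator p = record
    { to        = λ _ → p , indicator-self p
    ; from      = λ _ → zero
    ; to-cong   = λ _ → refl≈
    ; from-cong = λ _ → refl
    ; inverse   = (λ { {x , cx} _ → sym≈ (indicator⇒≈ cx) })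
                , (λ { {zero} _ → refl })
    }

  ColourClass-finite : ∀ {xs} → IsEnumeration S xs → ∀ {d} (c : Colouring S d) i →
    ∃[ m ] HasSize (ColourClass c i) m
  ColourClass-finite enum c i =
    enumerated⇒HasSize (On.decSetoid {B = Σ Carrier λ x → Func.to c x ≡ i} S? proj₁)
      λ { (x , cx) → restrict⁺ (λ x → Func.to c x Fin.≟ i)
                       (λ x≈y → trans (sym (Func.cong c x≈y)) cx) (enum x) }

  empty-class : ∀ {d} {c : Colouring S d} {i} → HasSize (ColourClass c i) 0 →
    ∀ x → Func.to c x ≢ i
  empty-class size x cx with () ← Inverse.from size (x , cx)

  Constant : ∀ {d} → Colouring S d → Set
  Constant c = ∀ x y → Func.to c x ≡ Func.to c y

  -- A minimum of 0 means that one class is empty, so everything has the other colour. This is what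
  -- rules out cost 0.
  smaller-class-empty⇒constant : ∀ {c : Colouring S 2} → SmallerClassSize c 0 → Constant c
  smaller-class-empty⇒constant {c} (zero , b , size₀ , _ , _) x y =
    trans (one x) (sym (one y))
    where
    one : ∀ x → Func.to c x ≡ suc zero
    one x with Func.to c x in cx
    ... | zero     = contradiction cx (empty-class {c = c} size₀ x)
    ... | suc zero = refl
  smaller-class-empty⇒constant {c} (suc a , zero , _ , size₁ , _) x y =
    trans (nought x) (sym (nought y))
    where
    nought : ∀ x → Func.to c x ≡ zero
    nought x with Func.to c x in cx
    ... | zero     = refl
    ... | suc zero = contradiction cx (empty-class {c = c} size₁ x)

  -- `Good` stands for `Distinguishing` or `EdgeDistinguishing`, so one argument serves both costs.
  module _ (Good : ∀ {d} → Colouring S d → Set)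
           (constant⇒bad : ∀ {d} (c : Colouring S d) → Constant c → ¬ Good c)
           {p : Carrier} (indicator-good : Good (indicator p)) where

    least-colours : IsLeast (λ d → ∃[ c ] Good {d} c) 2
    least-colours = (indicator p , indicator-good) , λ
      -- With no colours, `p` cannot be coloured; with one colour, every colouring is constant.
      { zero    (c , _)    → contradiction (Func.to c p) λ ()
      ; (suc zero) (c , good) → contradiction good (constant⇒bad c λ x y → Fin1 _ _)
      ; (suc (suc d)) _    → s≤s (s≤s z≤n)
      }
      where
      Fin1 : (i j : Fin 1) → i ≡ j
      Fin1 zero zero = refl

    least-cost : ∀ {xs} → IsEnumeration S xs →
      IsLeast (λ s → ∃[ c ] Good {2} c × SmallerClassSize c s) 1
    least-cost enum with ColourClass-finite enum (indicator p) zero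
    ... | a , size₀ =
      (indicator p , indicator-good , subst (SmallerClassSize (indicator p)) a⊓1≡1 small) ,
      positive
      where
      positive : ∀ s → (∃[ c ] Good {2} c × SmallerClassSize c s) → 1 ≤ s
      positive zero    (c , good , small) =
        contradiction good (constant⇒bad c (smaller-class-empty⇒constant {c} small))
      positive (suc s) _ = s≤s z≤n
      small : SmallerClassSize (indicator p) (a ⊓ 1)
      small = a , 1 , size₀ , HasSize-indicator p , refl
      -- The size `a` of the large class is never computed: `positive`, applied to the indicator
      -- itself, excludes a minimum of 0.
      a⊓1≡1 : a ⊓ 1 ≡ 1
      a⊓1≡1 = ≤-antisym (m⊓n≤n a 1) (positive _ (indicator p , indicator-good , small))

-- Sums and absolute differences

sum-mono-≤ : ∀ {n} {f g : Fin n → ℕ} → (∀ i → f i ≤ g i) → sum f ≤ sum g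
sum-mono-≤ {zero}  f≤g = z≤n
sum-mono-≤ {suc n} f≤g = +-mono-≤ (f≤g zero) (sum-mono-≤ (f≤g ∘ suc))

-- Equal totals leave no slack in any of the termwise bounds. This is the tool that turns equalities
-- of distances into equalities of coordinates.
sum-≡⇒≗ : ∀ {n} {f g : Fin n → ℕ} → (∀ i → f i ≤ g i) → sum f ≡ sum g → f ≗ g
sum-≡⇒≗ {suc n} {f} {g} f≤g eq = λ
  { zero    → f₀≡g₀
  ; (suc i) → sum-≡⇒≗ (f≤g ∘ suc)
      (+-cancelˡ-≡ (f zero) _ _ (trans eq (cong (_+ _) (sym f₀≡g₀)))) i
  }
  where
  f₀≡g₀ : f zero ≡ g zero
  f₀≡g₀ = ≤-antisym (f≤g zero) (+-cancelʳ-≤ (sum (f ∘ suc)) _ _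
    (≤-trans (+-monoʳ-≤ (g zero) (sum-mono-≤ (f≤g ∘ suc))) (≤-reflexive (sym eq))))

-- The multiple by `x` of the `j`-th unit vector.
point : ∀ {n} → Fin n → ℕ → Fin n → ℕ
point j x = updateAt (const 0) j (const x)

sum-point : ∀ {n} (j : Fin n) x → sum (point j x) ≡ x
sum-point {suc n} zero    x = trans (cong (x +_) (sum-replicate-zero n)) (+-identityʳ x)
sum-point         (suc j) x = sum-point j x

∣-∣≡bound⇒extreme : ∀ {N a b} → a ≤ N → b ≤ N → ∣ a - b ∣ ≡ N → a ≡ 0 ⊎ a ≡ N
∣-∣≡bound⇒extreme {N} {a} {b} a≤N b≤N eq with ≤-total a b
... | inj₁ a≤b = inj₁ (n≤0⇒n≡0 (+-cancelˡ-≤ N a 0 (begin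
  N + a          ≡⟨ cong (_+ a) (trans (sym eq) (m≤n⇒∣m-n∣≡n∸m a≤b)) ⟩
  (b ∸ a) + a    ≡⟨ m∸n+n≡m a≤b ⟩
  b              ≤⟨ b≤N ⟩
  N              ≡⟨ +-identityʳ N ⟨
  N + 0          ∎)))
  where open ≤-Reasoning
... | inj₂ b≤a = inj₂ (≤-antisym a≤N (begin
  N              ≡⟨ trans (sym eq) (m≤n⇒∣n-m∣≡n∸m b≤a) ⟩
  a ∸ b          ≤⟨ m∸n≤m a b ⟩
  a              ∎))
  where open ≤-Reasoning

module _ {N a : ℕ} (2a<N : a + a < N) where

  half⇒≤ : a ≤ N
  half⇒≤ = ≤-trans (m≤m+n a a) (<⇒≤ 2a<N)

  0-nearest : ∀ {x} → x ≡ 0 ⊎ x ≡ N → a ≤ ∣ x - a ∣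
  0-nearest (inj₁ refl) = ≤-refl
  0-nearest (inj₂ refl) = subst (a ≤_) (sym (m≤n⇒∣n-m∣≡n∸m half⇒≤)) (m+n≤o⇒m≤o∸n a (<⇒≤ 2a<N))

  -- The distance from `a` to `N` is `N ∸ a`, which exceeds `a` because `2a<N` is strict.
  0-unique-nearest : ∀ {x} → x ≡ 0 ⊎ x ≡ N → a ≡ ∣ x - a ∣ → x ≡ 0
  0-unique-nearest (inj₁ x≡0)  _  = x≡0
  0-unique-nearest (inj₂ refl) eq = contradiction
    (begin
      a + a        ≡⟨ cong (_+ a) (trans eq (m≤n⇒∣n-m∣≡n∸m half⇒≤)) ⟩
      (N ∸ a) + a  ≡⟨ m∸n+n≡m half⇒≤ ⟩
      N            ∎)
    (<⇒≢ 2a<N)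
    where open ≡-Reasoning

-- Powers of a path in coordinates

module _ {N : ℕ} where

  -- The exponent is `suc k`, so that recursion on `k` ends at the path itself. The path has `suc N`
  -- vertices, so that `N` is the largest coordinate.
  V : ℕ → Set
  V k = Graph.Vertex (Path (suc N) ^□ suc k)

  Adj : (k : ℕ) → V k → V k → Set
  Adj k = Graph._~_ (Path (suc N) ^□ suc k)

  coord : ∀ k → V k → Fin (suc k) → Fin (suc N)
  coord zero    x       _       = x
  coord (suc k) (x , v) zero    = x
  coord (suc k) (x , v) (suc i) = coord k v i

  vertex : ∀ k → (Fin (suc k) → Fin (suc N)) → V k
  vertex zero    f = f zero
  vertex (suc k) f = f zero , vertex k (f ∘ suc)

  coord-vertex : ∀ k f → coord k (vertex k f) ≗ f
  coord-vertex zero    f zero    = refl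
  coord-vertex (suc k) f zero    = refl
  coord-vertex (suc k) f (suc i) = coord-vertex k (f ∘ suc) i

  vertex-Adj : ∀ k {x y} (h : Fin k → Fin (suc N)) → Adj zero x y →
    Adj k (vertex k (x ◂ h)) (vertex k (y ◂ h))
  vertex-Adj zero    h x~y = x~y
  vertex-Adj (suc k) h x~y = inj₂ (x~y , refl)

  pos : ∀ k → V k → Fin (suc k) → ℕ
  pos k v i = toℕ (coord k v i)

  pos≤N : ∀ k (v : V k) i → pos k v i ≤ N
  pos≤N k v i = Fin.toℕ≤pred[n] (coord k v i)

  coord-injective : ∀ k {u v} → (∀ i → pos k u i ≡ pos k v i) → u ≡ v
  coord-injective zero    eq = Fin.toℕ-injective (eq zero)
  coord-injective (suc k) eq =
    cong₂ _,_ (Fin.toℕ-injective (eq zero)) (coord-injective k (eq ∘ suc))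

  -- The ℓ¹ distance. By `Adj⇒dist≡1`, `dist-triangle` and `step` it is the graph distance.
  dist : ∀ k → V k → V k → ℕ
  dist k u v = sum λ i → ∣ pos k u i - pos k v i ∣

  dist-refl : ∀ k v → dist k v v ≡ 0
  dist-refl k v = trans (sum-cong-≗ λ i → ∣n-n∣≡0 (pos k v i)) (sum-replicate-zero (suc k))

  dist-comm : ∀ k u v → dist k u v ≡ dist k v u
  dist-comm k u v = sum-cong-≗ λ i → ∣-∣-comm (pos k u i) (pos k v i)

  dist-triangle : ∀ k u v w → dist k u w ≤ dist k u v + dist k v w
  dist-triangle k u v w = ≤-trans
    (sum-mono-≤ λ i → ∣-∣-triangle (pos k u i) (pos k v i) (pos k w i))
    (≤-reflexive (∑-distrib-+ (λ i → ∣ pos k u i - pos k v i ∣)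
                              (λ i → ∣ pos k v i - pos k w i ∣)))

  dist≡0⇒≡ : ∀ k {u v} → dist k u v ≡ 0 → u ≡ v
  dist≡0⇒≡ k {u} {v} eq = coord-injective k λ i → ∣m-n∣≡0⇒m≡n
    (sym (sum-≡⇒≗ {f = const 0} {λ i → ∣ pos k u i - pos k v i ∣} (λ _ → z≤n)
      (trans (sum-replicate-zero (suc k)) (sym eq)) i))

  path-Adj⇒∣-∣≡1 : ∀ {x y} → Adj zero x y → ∣ toℕ x - toℕ y ∣ ≡ 1
  path-Adj⇒∣-∣≡1 {x} {y} (inj₁ sx≡y) rewrite sym sx≡y | +-comm 1 (toℕ x) = ∣m-m+n∣≡n (toℕ x) 1
  path-Adj⇒∣-∣≡1 {x} {y} (inj₂ sy≡x) rewrite sym sy≡x | +-comm 1 (toℕ y) =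
    trans (∣-∣-comm (toℕ y + 1) (toℕ y)) (∣m-m+n∣≡n (toℕ y) 1)

  Adj⇒dist≡1 : ∀ k {u v} → Adj k u v → dist k u v ≡ 1
  Adj⇒dist≡1 zero    x~y = trans (+-identityʳ _) (path-Adj⇒∣-∣≡1 x~y)
  Adj⇒dist≡1 (suc k) {x , u} (inj₁ (refl , u~v)) = cong₂ _+_ (∣n-n∣≡0 (toℕ x)) (Adj⇒dist≡1 k u~v)
  Adj⇒dist≡1 (suc k) {x , u} (inj₂ (x~y , refl)) = cong₂ _+_ (path-Adj⇒∣-∣≡1 x~y) (dist-refl k u)

-- Geodesics

path-step : ∀ {n} (x y : Fin n) {d} → ∣ toℕ x - toℕ y ∣ ≡ suc d →
  ∃[ z ] Graph._~_ (Path n) x z × ∣ toℕ z - toℕ y ∣ ≡ d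
-- The second split of `y` shows that the path has a vertex `suc zero` to move to.
path-step zero    (suc zero)      eq = suc zero , inj₁ refl , suc-injective eq
path-step zero    (suc (suc y))   eq = suc zero , inj₁ refl , suc-injective eq
path-step (suc x) zero            eq =
  inject₁ x , inj₂ (cong suc (Fin.toℕ-inject₁ x)) ,
  trans (∣-∣-identityʳ _) (trans (Fin.toℕ-inject₁ x) (suc-injective eq))
path-step (suc x) (suc y)         eq with path-step x y eq
... | z , x~z , eq′ = suc z , Sum.map (cong suc) (cong suc) x~z , eq′

module _ {N : ℕ} where

  -- The first coordinate in which `u` and `v` differ moves by one towards `v`.
  step : ∀ k (u v : V {N} k) {d} → dist k u v ≡ suc d → ∃[ w ] Adj k u w × dist k w v ≡ d
  step zero    x y eq with path-step x y (trans (sym (+-identityʳ _)) eq)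
  ... | z , x~z , eq′ = z , x~z , trans (+-identityʳ _) eq′
  step (suc k) (x , u) (y , v) eq with ∣ toℕ x - toℕ y ∣ in ∣x-y∣
  ... | zero with step k u v eq
  ...   | w , u~w , eq′ = (x , w) , inj₁ (refl , u~w) , cong₂ _+_ ∣x-y∣ eq′
  step (suc k) (x , u) (y , v) eq | suc e with path-step x y ∣x-y∣
  ...   | z , x~z , eq′ = (z , u) , inj₂ (x~z , refl) ,
    trans (cong (_+ dist k u v) eq′) (suc-injective eq)

  -- A geodesic from `u` to `v`, unrolled by `step`, is mapped to a walk of the same length.
  hom-contracts-dist : ∀ k (f : V {N} k → V {N} k) → (∀ {u v} → Adj k u v → Adj k (f u) (f v)) →
    ∀ u v → dist k (f u) (f v) ≤ dist k u v
  hom-contracts-dist k f f-hom u v = go u v _ refl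
    where
    go : ∀ u v d → dist k u v ≡ d → dist k (f u) (f v) ≤ dist k u v
    go u v zero    eq rewrite dist≡0⇒≡ k eq =
      ≤-reflexive (trans (dist-refl k (f v)) (sym (dist-refl k v)))
    go u v (suc d) eq with step k u v eq
    ... | w , u~w , eq′ = begin
      dist k (f u) (f v)                       ≤⟨ dist-triangle k (f u) (f w) (f v) ⟩
      dist k (f u) (f w) + dist k (f w) (f v)
        ≤⟨ +-mono-≤ (≤-reflexive (Adj⇒dist≡1 k (f-hom u~w))) (go w v d eq′) ⟩
      1 + dist k w v                           ≡⟨ cong suc eq′ ⟩
      suc d                                    ≡⟨ eq ⟨
      dist k u v                               ∎
      where open ≤-Reasoning

  -- Reflection in the centre

  -- It serves twice: as the automorphism that constant colourings fail to exclude, and as the map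
  -- from a corner to a vertex at maximal distance.
  reflect : ∀ k → V {N} k → V {N} k
  reflect zero    x       = opposite x
  reflect (suc k) (x , v) = opposite x , reflect k v

  reflect-involutive : ∀ k v → reflect k (reflect k v) ≡ v
  reflect-involutive zero    x       = Fin.opposite-involutive x
  reflect-involutive (suc k) (x , v) = cong₂ _,_ (Fin.opposite-involutive x) (reflect-involutive k v)

  coord-reflect : ∀ k v i → coord k (reflect k v) i ≡ opposite (coord k v i)
  coord-reflect zero    x       i       = refl
  coord-reflect (suc k) (x , v) zero    = refl
  coord-reflect (suc k) (x , v) (suc i) = coord-reflect k v i

  pos-reflect : ∀ k v i → pos k (reflect k v) i ≡ N ∸ pos k v i
  pos-reflect k v i = trans (cong toℕ (coord-reflect k v i)) (Fin.opposite-prop (coord k v i))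

  suc-opposite : ∀ {x y : Fin (suc N)} → suc (toℕ x) ≡ toℕ y →
    suc (toℕ (opposite y)) ≡ toℕ (opposite x)
  suc-opposite {x} {y} sx≡y = begin
    suc (toℕ (opposite y))  ≡⟨ cong suc (Fin.opposite-prop y) ⟩
    suc (N ∸ toℕ y)         ≡⟨ cong (λ z → suc (N ∸ z)) sx≡y ⟨
    suc (N ∸ suc (toℕ x))   ≡⟨ +-∸-assoc 1 (subst (_≤ N) (sym sx≡y) (Fin.toℕ≤pred[n] y)) ⟨
    N ∸ toℕ x               ≡⟨ Fin.opposite-prop x ⟨
    toℕ (opposite x)        ∎
    where open ≡-Reasoning

  opposite-Adj : ∀ {x y} → Adj {N} zero x y → Adj {N} zero (opposite x) (opposite y)
  opposite-Adj (inj₁ p) = inj₂ (suc-opposite p)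
  opposite-Adj (inj₂ p) = inj₁ (suc-opposite p)

  reflect-Adj : ∀ k {u v} → Adj k u v → Adj k (reflect k u) (reflect k v)
  reflect-Adj zero    x~y                = opposite-Adj x~y
  reflect-Adj (suc k) (inj₁ (refl , u~v)) = inj₁ (refl , reflect-Adj k u~v)
  reflect-Adj (suc k) (inj₂ (x~y , refl)) = inj₂ (opposite-Adj x~y , refl)

  reflection : ∀ k → Automorphism (Path (suc N) ^□ suc k)
  reflection k = record
    { bijection = mk↔ₛ′ (reflect k) (reflect k) (reflect-involutive k) (reflect-involutive k)
    ; preserves = mk⇔ (reflect-Adj k) λ ru~rv →
        subst₂ (Adj k) (reflect-involutive k _) (reflect-involutive k _) (reflect-Adj k ru~rv)
    }

  reflection-≢-identity : 0 < N → ∀ k → ¬ IsIdentity (Path (suc N) ^□ suc k) (reflection k)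
  reflection-≢-identity 0<N k fixes = <⇒≢ 0<N (begin
    0                         ≡⟨ cong toℕ (coord-vertex k (const zero) zero) ⟨
    pos k o zero              ≡⟨ cong (λ v → pos k v zero) (fixes o) ⟨
    pos k (reflect k o) zero  ≡⟨ pos-reflect k o zero ⟩
    N ∸ pos k o zero          ≡⟨ cong (λ x → N ∸ toℕ x) (coord-vertex k (const zero) zero) ⟩
    N                         ∎)
    where
    open ≡-Reasoning
    o = vertex k (const zero)

  -- Corners

  Corner : ∀ k → V {N} k → Set
  Corner k v = ∀ i → pos k v i ≡ 0 ⊎ pos k v i ≡ N

  -- No summand of the distance exceeds `N`, so at the diameter each equals `N`. Together with
  -- `dist-Corner-reflect` this characterises corners by distances alone.
  dist-extreme⇒Corner : ∀ k {u v} → dist k u v ≡ sum {suc k} (const N) → Corner k u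
  dist-extreme⇒Corner k {u} {v} eq i = ∣-∣≡bound⇒extreme (pos≤N k u i) (pos≤N k v i)
    (sum-≡⇒≗ bounded eq i)
    where
    bounded : ∀ i → ∣ pos k u i - pos k v i ∣ ≤ N
    bounded i = ≤-trans (∣m-n∣≤m⊔n (pos k u i) (pos k v i)) (⊔-lub (pos≤N k u i) (pos≤N k v i))

  dist-Corner-reflect : ∀ k {v} → Corner k v → dist k v (reflect k v) ≡ sum {suc k} (const N)
  dist-Corner-reflect k {v} corner = sum-cong-≗ λ i →
    trans (cong ∣ pos k v i -_∣ (pos-reflect k v i)) (extreme (corner i))
    where
    extreme : ∀ {a} → a ≡ 0 ⊎ a ≡ N → ∣ a - (N ∸ a) ∣ ≡ N
    extreme (inj₁ refl) = refl
    extreme (inj₂ refl) = trans (cong ∣ N -_∣ (n∸n≡0 N)) (∣-∣-identityʳ N)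

  origin : ∀ k → V {N} k
  origin k = vertex k (const zero)

  pos-origin : ∀ k i → pos k (origin k) i ≡ 0
  pos-origin k i = cong toℕ (coord-vertex k (const zero) i)

  origin-Corner : ∀ k → Corner k (origin k)
  origin-Corner k i = inj₁ (pos-origin k i)

  dist-origin : ∀ k v → dist k v (origin k) ≡ sum (pos k v)
  dist-origin k v = sum-cong-≗ λ i →
    trans (cong ∣ pos k v i -_∣ (pos-origin k i)) (∣-∣-identityʳ (pos k v i))

  spike : ∀ k → Fin (suc k) → V {N} k
  spike k j = vertex k (updateAt (const zero) j (const (fromℕ N)))

  pos-spike-≡ : ∀ k j → pos k (spike k j) j ≡ N
  pos-spike-≡ k j = begin
    pos k (spike k j) j                                     ≡⟨ cong toℕ (coord-vertex k _ j) ⟩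
    toℕ (updateAt (const zero) j (const (fromℕ N)) j)       ≡⟨ cong toℕ (updateAt-updates j (const zero)) ⟩
    toℕ (fromℕ N)                                           ≡⟨ Fin.toℕ-fromℕ N ⟩
    N                                                       ∎
    where open ≡-Reasoning

  pos-spike-≢ : ∀ k {i j} → i ≢ j → pos k (spike k j) i ≡ 0
  pos-spike-≢ k {i} {j} i≢j =
    cong toℕ (trans (coord-vertex k _ i) (updateAt-minimal i j (const zero) i≢j))

  pos-spike : ∀ k j → pos k (spike k j) ≗ point j N
  pos-spike k j i with i Fin.≟ j
  ... | yes refl = trans (pos-spike-≡ k j) (sym (updateAt-updates j (const 0)))
  ... | no  i≢j  = trans (pos-spike-≢ k i≢j) (sym (updateAt-minimal i j (const 0) i≢j))

  spike-Corner : ∀ k j → Corner k (spike k j)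
  spike-Corner k j i with i Fin.≟ j
  ... | yes refl = inj₂ (pos-spike-≡ k j)
  ... | no  i≢j  = inj₁ (pos-spike-≢ k i≢j)

  sum-pos-spike : ∀ k j → sum (pos k (spike k j)) ≡ N
  sum-pos-spike k j = trans (sum-cong-≗ (pos-spike k j)) (sum-point j N)

  -- ∣ v_j - N ∣ = N - v_j, both sides moved so that no subtraction occurs.
  dist-spike : ∀ k v j → dist k v (spike k j) + (pos k v j + pos k v j) ≡ sum (pos k v) + N
  dist-spike k v j = begin
    dist k v (spike k j) + 2v          ≡⟨ cong (dist k v (spike k j) +_) (sum-point j 2v) ⟨
    dist k v (spike k j) + sum (point j 2v)
      ≡⟨ ∑-distrib-+ (λ i → ∣ pos k v i - pos k (spike k j) i ∣) (point j 2v) ⟨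
    sum (λ i → ∣ pos k v i - pos k (spike k j) i ∣ + point j 2v i)
      ≡⟨ sum-cong-≗ pointwise ⟩
    sum (λ i → pos k v i + point j N i)
      ≡⟨ ∑-distrib-+ (pos k v) (point j N) ⟩
    sum (pos k v) + sum (point j N)    ≡⟨ cong (sum (pos k v) +_) (sum-point j N) ⟩
    sum (pos k v) + N                  ∎
    where
    open ≡-Reasoning
    2v = pos k v j + pos k v j
    pointwise : ∀ i → ∣ pos k v i - pos k (spike k j) i ∣ + point j 2v i ≡ pos k v i + point j N i
    pointwise i with i Fin.≟ j
    ... | yes refl rewrite pos-spike-≡ k j
                         | updateAt-updates j {const 2v} (const 0)
                         | updateAt-updates j {const N} (const 0) = begin
      ∣ x - N ∣ + (x + x)      ≡⟨ cong (_+ (x + x)) (m≤n⇒∣m-n∣≡n∸m (pos≤N k v j)) ⟩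
      (N ∸ x) + (x + x)        ≡⟨ +-assoc (N ∸ x) x x ⟨
      ((N ∸ x) + x) + x        ≡⟨ cong (_+ x) (m∸n+n≡m (pos≤N k v j)) ⟩
      N + x                    ≡⟨ +-comm N x ⟩
      x + N                    ∎
      where x = pos k v j
    ... | no  i≢j  rewrite pos-spike-≢ k i≢j
                         | updateAt-minimal i j {const 2v} (const 0) i≢j
                         | updateAt-minimal i j {const N} (const 0) i≢j =
      cong (_+ 0) (∣-∣-identityʳ (pos k v i))

  -- By `dist-spike`, twice the coordinate is the distance to the origin plus `N` minus the distance
  -- to the spike. It is applied both to one vertex with two indices and to two vertices with one
  -- index.
  dist-spike-determines-pos : ∀ k {u v i j} → dist k u (origin k) ≡ dist k v (origin k) →
    dist k u (spike k i) ≡ dist k v (spike k j) → pos k u i ≡ pos k v j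
  dist-spike-determines-pos k {u} {v} {i} {j} eq₀ eq =
    double-injective (+-cancelˡ-≡ (dist k v (spike k j)) _ _ (begin
    dist k v (spike k j) + (pos k u i + pos k u i)  ≡⟨ cong (_+ (pos k u i + pos k u i)) eq ⟨
    dist k u (spike k i) + (pos k u i + pos k u i)  ≡⟨ dist-spike k u i ⟩
    sum (pos k u) + N
      ≡⟨ cong (_+ N) (trans (sym (dist-origin k u)) (trans eq₀ (dist-origin k v))) ⟩
    sum (pos k v) + N                               ≡⟨ dist-spike k v j ⟨
    dist k v (spike k j) + (pos k v j + pos k v j)  ∎))
    where
    open ≡-Reasoning
    double-injective : ∀ {a b} → a + a ≡ b + b → a ≡ b
    double-injective {zero}  {zero}  _ = refl
    double-injective {suc a} {suc b} p = cong suc (double-injective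
      (suc-injective (trans (sym (+-suc a a)) (trans (suc-injective p) (+-suc b b)))))

  -- As the sum is positive, some coordinate `j` is nonzero, hence `N`. So `spike k j` lies below
  -- `y` termwise and has the same sum.
  Corner-of-sum-N : ∀ k {y} → 0 < N → Corner k y → sum (pos k y) ≡ N → ∃[ j ] y ≡ spike k j
  Corner-of-sum-N k {y} 0<N corner Σy≡N = j , sym (coord-injective k (sum-≡⇒≗ spike≤y
    (trans (sum-pos-spike k j) (sym Σy≡N))))
    where
    nonzero : ∃[ j ] pos k y j ≢ 0
    nonzero = Fin.¬∀⟶∃¬ (suc k) _ (λ j → pos k y j ≟ℕ 0) λ zeros →
      <⇒≢ 0<N (trans (sym (trans (sum-cong-≗ zeros) (sum-replicate-zero (suc k)))) Σy≡N)
    j = proj₁ nonzero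
    spike≤y : ∀ i → pos k (spike k j) i ≤ pos k y i
    spike≤y i with i Fin.≟ j
    ... | yes refl = ≤-trans (pos≤N k (spike k j) j)
      (≤-reflexive ([ (λ p → contradiction p (proj₂ nonzero)) , sym ] (corner j)))
    ... | no i≢j   = ≤-trans (≤-reflexive (pos-spike-≢ k i≢j)) z≤n

  -- Vertices fixed by an automorphism

  module _ (k : ℕ) (φ : Automorphism (Path (suc N) ^□ suc k)) where
    open Automorphism φ renaming (to to φ⟨_⟩)
    open Inverse bijection using (strictlyInverseˡ; strictlyInverseʳ)

    from-Adj : ∀ {u v} → Adj k u v → Adj k (from u) (from v)
    from-Adj u~v = Equivalence.from preserves
      (subst₂ (Adj k) (sym (strictlyInverseˡ _)) (sym (strictlyInverseˡ _)) u~v)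

    -- Both the automorphism and its inverse contract distances.
    automorphism-preserves-dist : ∀ u v → dist k φ⟨ u ⟩ φ⟨ v ⟩ ≡ dist k u v
    automorphism-preserves-dist u v = ≤-antisym
      (hom-contracts-dist k φ⟨_⟩ (Equivalence.to preserves) u v)
      (subst₂ (λ u′ v′ → dist k u′ v′ ≤ dist k φ⟨ u ⟩ φ⟨ v ⟩) (strictlyInverseʳ u) (strictlyInverseʳ v)
        (hom-contracts-dist k from from-Adj φ⟨ u ⟩ φ⟨ v ⟩))

    dist-fixed : ∀ {a} → φ⟨ a ⟩ ≡ a → ∀ v → dist k a φ⟨ v ⟩ ≡ dist k a v
    dist-fixed {a} φa≡a v =
      trans (cong (λ a → dist k a φ⟨ v ⟩) (sym φa≡a)) (automorphism-preserves-dist a v)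

    automorphism-preserves-Corner : ∀ {v} → Corner k v → Corner k φ⟨ v ⟩
    automorphism-preserves-Corner {v} corner = dist-extreme⇒Corner k
      (trans (automorphism-preserves-dist v (reflect k v)) (dist-Corner-reflect k corner))

    -- The image of the origin is a corner whose distance to `a` is the sum of the coordinates of
    -- `a`. Each coordinate of a corner contributes at least its term of that sum, so each
    -- contributes exactly that and must be 0.
    fixes-origin : ∀ {a} → (∀ i → pos k a i + pos k a i < N) → φ⟨ a ⟩ ≡ a → φ⟨ origin k ⟩ ≡ origin k
    fixes-origin {a} half φa≡a = coord-injective k λ i →
      trans (0-unique-nearest (half i) (φo-Corner i) (nearest i)) (sym (pos-origin k i))
      where
      φo-Corner = automorphism-preserves-Corner (origin-Corner k)
      nearest : ∀ i → pos k a i ≡ ∣ pos k φ⟨ origin k ⟩ i - pos k a i ∣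
      nearest = sum-≡⇒≗ (λ i → 0-nearest (half i) (φo-Corner i)) (begin
        sum (pos k a)            ≡⟨ dist-origin k a ⟨
        dist k a (origin k)      ≡⟨ dist-fixed φa≡a (origin k) ⟨
        dist k a φ⟨ origin k ⟩   ≡⟨ dist-comm k a φ⟨ origin k ⟩ ⟩
        dist k φ⟨ origin k ⟩ a   ∎)
        where open ≡-Reasoning

    module _ {a b : V {N} k}
             (half : ∀ i → pos k a i + pos k a i < N)
             (separated : ∀ {i j} → pos k a i ≡ pos k a j → pos k b i ≡ pos k b j → i ≡ j)
             (φa≡a : φ⟨ a ⟩ ≡ a) (φb≡b : φ⟨ b ⟩ ≡ b) where

      φo≡o : φ⟨ origin k ⟩ ≡ origin k
      φo≡o = fixes-origin half φa≡a

      dist-origin-invariant : ∀ v → dist k φ⟨ v ⟩ (origin k) ≡ dist k v (origin k)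
      dist-origin-invariant v =
        trans (cong (dist k φ⟨ v ⟩) (sym φo≡o)) (automorphism-preserves-dist v (origin k))

      fixes-spike : ∀ i → φ⟨ spike k i ⟩ ≡ spike k i
      fixes-spike i with Corner-of-sum-N k {φ⟨ spike k i ⟩} (≤-trans (s≤s z≤n) (half zero))
        (automorphism-preserves-Corner (spike-Corner k i))
        (trans (sym (dist-origin k φ⟨ spike k i ⟩)) (trans (dist-origin-invariant (spike k i))
          (trans (dist-origin k (spike k i)) (sum-pos-spike k i))))
      -- The fixed vertices `a` and `b` are as far from spike `j` as from spike `i`, so neither
      -- tells the coordinates `i` and `j` apart.
      ... | j , φs≡s = trans φs≡s (cong (spike k) (separated (same φa≡a) (same φb≡b)))
        where
        same : ∀ {c} → φ⟨ c ⟩ ≡ c → pos k c j ≡ pos k c i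
        same {c} φc≡c = dist-spike-determines-pos k {c} {c} refl
          (trans (cong (dist k c) (sym φs≡s)) (dist-fixed φc≡c (spike k i)))

      -- The origin and the spikes form a resolving set, and all of them are fixed.
      rigid : IsIdentity (Path (suc N) ^□ suc k) φ
      rigid v = coord-injective k λ i → dist-spike-determines-pos k (dist-origin-invariant v)
        (trans (cong (dist k φ⟨ v ⟩) (sym (fixes-spike i))) (automorphism-preserves-dist v (spike k i)))

    -- All corners are farther from b than the origin is from a: in the
    -- coordinate j, where b is neither 0 nor N, they differ from b.
    no-swap : ∀ {a b j} → pos k a j ≡ 0 → ¬ (pos k b j ≡ 0 ⊎ pos k b j ≡ N) →
      (∀ i → i ≢ j → pos k b i ≡ pos k a i) → (∀ i → pos k a i + pos k a i < N) → φ⟨ a ⟩ ≢ b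
    no-swap {a} {b} {j} aⱼ≡0 b-inner b≡a half φa≡b =
      b-inner (subst (λ x → x ≡ 0 ⊎ x ≡ N) (∣m-n∣≡0⇒m≡n (trans (sym (equal j)) aⱼ≡0)) (φo-Corner j))
      where
      φo-Corner = automorphism-preserves-Corner (origin-Corner k)
      near : ∀ i → pos k a i ≤ ∣ pos k φ⟨ origin k ⟩ i - pos k b i ∣
      near i with i Fin.≟ j
      ... | yes refl = ≤-trans (≤-reflexive aⱼ≡0) z≤n
      ... | no  i≢j  rewrite b≡a i i≢j = 0-nearest (half i) (φo-Corner i)
      equal : ∀ i → pos k a i ≡ ∣ pos k φ⟨ origin k ⟩ i - pos k b i ∣
      equal = sum-≡⇒≗ near (begin
        sum (pos k a)                ≡⟨ dist-origin k a ⟨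
        dist k a (origin k)          ≡⟨ automorphism-preserves-dist a (origin k) ⟨
        dist k φ⟨ a ⟩ φ⟨ origin k ⟩  ≡⟨ cong (λ v → dist k v φ⟨ origin k ⟩) φa≡b ⟩
        dist k b φ⟨ origin k ⟩       ≡⟨ dist-comm k b φ⟨ origin k ⟩ ⟩
        dist k φ⟨ origin k ⟩ b       ∎)
        where open ≡-Reasoning

  -- Finiteness

  path-Adj? : Decidable (Adj {N} zero)
  path-Adj? x y = (suc (toℕ x) ≟ℕ toℕ y) ⊎-dec (suc (toℕ y) ≟ℕ toℕ x)

  _≟ⱽ_ : ∀ {k} → DecidableEquality (V {N} k)
  _≟ⱽ_ {zero}  = Fin._≟_
  _≟ⱽ_ {suc k} = ≡-dec Fin._≟_ (_≟ⱽ_ {k})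

  Adj? : ∀ k → Decidable (Adj {N} k)
  Adj? zero    = path-Adj?
  Adj? (suc k) (x , u) (y , v) =
    ((x Fin.≟ y) ×-dec Adj? k u v) ⊎-dec (path-Adj? x y ×-dec (_≟ⱽ_ {k} u v))

  Vertices? : ℕ → DecSetoid 0ℓ 0ℓ
  Vertices? k = ≡.decSetoid (_≟ⱽ_ {k})

  Edges? : ℕ → DecSetoid 0ℓ 0ℓ
  Edges? k = record
    { Carrier          = Edge G
    ; _≈_              = _≈ₑ_ G
    ; isDecEquivalence = record
      { isEquivalence = Setoid.isEquivalence (Edges G)
      ; _≟_           = λ { (edge u v _) (edge u′ v′ _) →
          ((u ≟ u′) ×-dec (v ≟ v′)) ⊎-dec ((u ≟ v′) ×-dec (v ≟ u′)) }
      }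
    }
    where
    G = Path (suc N) ^□ suc k
    _≟_ = _≟ⱽ_ {k}

  vertices : ∀ k → List (V {N} k)
  vertices zero    = allFin _
  vertices (suc k) = cartesianProduct (allFin _) (vertices k)

  ∈-vertices : ∀ k v → v ∈ vertices k
  ∈-vertices zero    x       = ∈-allFin x
  ∈-vertices (suc k) (x , v) = ∈-cartesianProduct⁺ (∈-allFin x) (∈-vertices k v)

  -- Each edge occurs in both orientations, which an enumeration permits. The adjacency proofs come
  -- from `Adj?`; `≈ₑ` ignores them.
  edges : ∀ k → List (Edge (Path (suc N) ^□ suc k))
  edges k = map (λ { ((u , v) , u~v) → edge u v u~v })
    (restrict (λ { (u , v) → Adj? k u v }) (cartesianProduct (vertices k) (vertices k)))

  ∈-edges : ∀ k → IsEnumeration (Edges (Path (suc N) ^□ suc k)) (edges k)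
  ∈-edges k (edge u v u~v) = Any.map⁺ (Any.map (λ { refl → inj₁ (refl , refl) })
    (restrict⁺ (λ { (u , v) → Adj? k u v }) {Q = (u , v) ≡_} (λ { refl → u~v })
      (∈-cartesianProduct⁺ (∈-vertices k u) (∈-vertices k v))))

  -- Costs

  0<N⇒constant-not-Distinguishing : 0 < N → ∀ k {d}
    (c : Colouring (Vertices (Path (suc N) ^□ suc k)) d) →
    Constant (Vertices? k) c → ¬ Distinguishing (Path (suc N) ^□ suc k) c
  0<N⇒constant-not-Distinguishing 0<N k c constant dist =
    reflection-≢-identity 0<N k (dist (reflection k) λ v → constant _ _)

  0<N⇒constant-not-EdgeDistinguishing : 0 < N → ∀ k {d}
    (c : Colouring (Edges (Path (suc N) ^□ suc k)) d) →
    Constant (Edges? k) c → ¬ EdgeDistinguishing (Path (suc N) ^□ suc k) c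
  0<N⇒constant-not-EdgeDistinguishing 0<N k c constant dist =
    reflection-≢-identity 0<N k (dist (reflection k) λ e → constant _ _)

-- The coloured vertex and the coloured edge

i<⌊n/2⌋⇒i+i<n∸1 : ∀ {i N} → i < ⌊ suc N /2⌋ → i + i < N
i<⌊n/2⌋⇒i+i<n∸1 {i} {N} i<h = s≤s⁻¹ (begin
  suc (suc (i + i))              ≡⟨ cong suc (+-suc i i) ⟨
  -- One summand is bounded by the floor and the other by the ceiling, since these add up to exactly
  -- `suc N`.
  suc i + suc i                  ≤⟨ +-mono-≤ i<h (≤-trans i<h (⌊n/2⌋≤⌈n/2⌉ (suc N))) ⟩
  ⌊ suc N /2⌋ + ⌈ suc N /2⌉      ≡⟨ ⌊n/2⌋+⌈n/2⌉≡n (suc N) ⟩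
  suc N                          ∎)
  where open ≤-Reasoning

module _ (N : ℕ) {k : ℕ} (h : k ≤ ⌊ suc N /2⌋) where

  -- The coordinates 0, 1, ..., k - 1. Exactly ⌊n/2⌋ values, for n = `suc N`, lie below half of `N`,
  -- whence the bound on the exponent.
  ladder : Fin k → Fin (suc N)
  ladder i = fromℕ< (≤-trans (Fin.toℕ<n i) (≤-trans h (⌊n/2⌋≤n (suc N))))

  toℕ-ladder : ∀ i → toℕ (ladder i) ≡ toℕ i
  toℕ-ladder i = Fin.toℕ-fromℕ< _

  ladder-half : ∀ i → toℕ (ladder i) + toℕ (ladder i) < N
  ladder-half i = i<⌊n/2⌋⇒i+i<n∸1
    (subst (_< ⌊ suc N /2⌋) (sym (toℕ-ladder i)) (≤-trans (Fin.toℕ<n i) h))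

  ladder-injective : ∀ {i j} → toℕ (ladder i) ≡ toℕ (ladder j) → i ≡ j
  ladder-injective {i} {j} eq =
    Fin.toℕ-injective (trans (sym (toℕ-ladder i)) (trans eq (toℕ-ladder j)))

module _ (M : ℕ) where
  private
    N n : ℕ
    N = suc (suc M)
    n = suc N

  vertex-cost : ∀ t → suc t ≤ ⌊ n /2⌋ → ρ (Path n ^□ suc t) is 1
  vertex-cost t h =
    least-colours (Vertices? t) (Distinguishing G) constant⇒bad good ,
    least-cost    (Vertices? t) (Distinguishing G) constant⇒bad good (∈-vertices t)
    where
    constant⇒bad : ∀ {d} (c : Colouring (Vertices (Path n ^□ suc t)) d) →
      Constant (Vertices? t) c → ¬ Distinguishing (Path n ^□ suc t) c
    constant⇒bad = 0<N⇒constant-not-Distinguishing (s≤s z≤n) t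
    G = Path n ^□ suc t
    a = vertex t (ladder N h)
    pos-a : ∀ i → pos t a i ≡ toℕ (ladder N h i)
    pos-a i = cong toℕ (coord-vertex t (ladder N h) i)
    half : ∀ i → pos t a i + pos t a i < N
    half i rewrite pos-a i = ladder-half N h i
    good : Distinguishing G (indicator (Vertices? t) a)
    -- The coordinates of `a` are distinct, so `a` takes the place of both fixed vertices.
    good φ preserved = rigid t φ {a} {a} half
      (λ {i} {j} eq _ → ladder-injective N h (trans (sym (pos-a i)) (trans eq (pos-a j)))) φa≡a φa≡a
      where
      φa≡a : Automorphism.to φ a ≡ a
      φa≡a = indicator⇒≈ (Vertices? t) (trans (preserved a) (indicator-self (Vertices? t) a))

  -- The edge runs in an extra first coordinate, in which `a` repeats the ladder's value 0. The
  -- other end `b` has 1 there, which tells this coordinate apart and gains one dimension.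
  edge-cost : ∀ k → k ≤ ⌊ n /2⌋ → ρ′ (Path n ^□ suc k) is 1
  edge-cost k h =
    least-colours (Edges? k) (EdgeDistinguishing G) constant⇒bad {e} good ,
    least-cost    (Edges? k) (EdgeDistinguishing G) constant⇒bad {e} good (∈-edges k)
    where
    constant⇒bad : ∀ {d} (c : Colouring (Edges (Path n ^□ suc k)) d) →
      Constant (Edges? k) c → ¬ EdgeDistinguishing (Path n ^□ suc k) c
    constant⇒bad = 0<N⇒constant-not-EdgeDistinguishing (s≤s z≤n) k
    G = Path n ^□ suc k
    f g : Fin (suc k) → Fin n
    f = zero ◂ ladder N h
    g = suc zero ◂ ladder N h
    a = vertex k f
    b = vertex k g
    e = edge a b (vertex-Adj k (ladder N h) (inj₁ refl))
    pos-a : ∀ i → pos k a i ≡ toℕ (f i)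
    pos-a i = cong toℕ (coord-vertex k f i)
    pos-b : ∀ i → pos k b i ≡ toℕ (g i)
    pos-b i = cong toℕ (coord-vertex k g i)
    f-half : ∀ i → toℕ (f i) + toℕ (f i) < N
    f-half zero    = s≤s z≤n
    f-half (suc i) = ladder-half N h i
    half : ∀ i → pos k a i + pos k a i < N
    half i rewrite pos-a i = f-half i
    fg-separated : ∀ i j → toℕ (f i) ≡ toℕ (f j) → toℕ (g i) ≡ toℕ (g j) → i ≡ j
    fg-separated zero    zero    _  _  = refl
    -- On ladder coordinates `f` and `g` agree, so the common value would be both 0 and 1.
    fg-separated zero    (suc j) p  q  = contradiction (trans q (sym p)) λ ()
    fg-separated (suc i) zero    p  q  = contradiction (trans (sym q) p) λ ()
    fg-separated (suc i) (suc j) p  _  = cong suc (ladder-injective N h p)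
    separated : ∀ {i j} → pos k a i ≡ pos k a j → pos k b i ≡ pos k b j → i ≡ j
    separated {i} {j} p q = fg-separated i j
      (trans (sym (pos-a i)) (trans p (pos-a j))) (trans (sym (pos-b i)) (trans q (pos-b j)))
    b-inner : ¬ (pos k b zero ≡ 0 ⊎ pos k b zero ≡ N)
    -- Since `3 ≤ n`, the coordinate 1 is an inner vertex of the path.
    b-inner rewrite pos-b zero = [ (λ ()) , (λ ()) ]
    b≡a : ∀ i → i ≢ zero → pos k b i ≡ pos k a i
    b≡a zero    0≢0 = contradiction refl 0≢0
    b≡a (suc i) _   = trans (pos-b (suc i)) (sym (pos-a (suc i)))
    good : EdgeDistinguishing G (indicator (Edges? k) e)
    good φ preserved
      with indicator⇒≈ (Edges? k) {e} {mapEdge φ e} (trans (preserved e) (indicator-self (Edges? k) e))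
    ... | inj₁ (φa≡a , φb≡b) = rigid k φ {a} {b} half separated φa≡a φb≡b
    ... | inj₂ (φa≡b , _)    = contradiction φa≡b (no-swap k φ (pos-a zero) b-inner b≡a half)

theorem5p1 : (n : ℕ) → 3 ≤ n →
    (k t : ℕ) .{{_ : NonZero k}} .{{_ : NonZero t}} →
    (k ≤ 1 + ⌊ n /2⌋ → ρ′ (Path n ^□ k) is 1) ×
    (t ≤ ⌊ n /2⌋ → ρ (Path n ^□ t) is 1)
theorem5p1 (suc (suc (suc M))) (s≤s (s≤s (s≤s z≤n))) (suc k) (suc t) =
  -- The 1 in the bound `1 + ⌊ n /2⌋` pays for the direction of the edge; the other `k` coordinates
  -- form the ladder.
  (λ h → edge-cost M k (s≤s⁻¹ h)) , vertex-cost M t
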